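{- Let $G$ be a finite simple $2$-connected $3$-$\gamma_c$-vertex critical claw-free graph. Then $G$ is Hamiltonian.
   Context: A connected dominating set of a graph $G$ is a set $D \subseteq V(G)$ such that every vertex outside $D$ has a neighbor in $D$ and the induced subgraph $G[D]$ is connected; $\gamma_c(G)$ is the minimum size of a connected dominating set. A graph $G$ is $k$-$\gamma_c$-vertex critical if $\gamma_c(G)=k$ and $\gamma_c(G-v)<k$ for every vertex $v$ of $G$. A graph is claw-free if it has no induced subgraph isomorphic to $K_{1,3}$. -}

module Defs where

open import Data.Nat using (ℕ; _<_; _≤_)
open import Data.Fin using (Fin)
open import Data.Fin.Subset using (Subset; _∈_; _∉_; _⊆_; ∣_∣; ⊤; ⁅_⁆; ∁)
open import Data.Product using (Σ; _×_; ∃; ∃-syntax; _,_)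
open import Data.List using (List; []; _∷_; length)
open import Data.List.Relation.Unary.Unique.Propositional using (Unique)
import Data.List.Membership.Propositional as LM
open import Relation.Nullary using (¬_; Dec)
open import Relation.Binary.PropositionalEquality using (_≡_; _≢_)

record Graph (n : ℕ) : Set₁ where
  field
    Adj  : Fin n → Fin n → Set
    sym  : ∀ {x y} → Adj x y → Adj y x
    irr  : ∀ {x} → ¬ Adj x x
    dec  : ∀ x y → Dec (Adj x y)
open Graph public

module _ {n : ℕ} (G : Graph n) where

  data WalkIn (S : Subset n) : Fin n → Fin n → Set where
    here : ∀ {x} → x ∈ S → WalkIn S x x
    step : ∀ {x y z} → x ∈ S → Adj G x y → WalkIn S y z → WalkIn S x z

  ConnectedOn : Subset n → Set
  ConnectedOn S = ∀ x y → x ∈ S → y ∈ S → WalkIn S x y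

  -- D is a connected dominating set of the induced subgraph G[W]
  IsCDS : Subset n → Subset n → Set
  IsCDS W D =
    D ⊆ W
    × (∀ w → w ∈ W → w ∉ D → ∃[ u ] (u ∈ D × Adj G w u))
    × ConnectedOn D

  γc≡ : Subset n → ℕ → Set
  γc≡ W k =
    (∃[ D ] (IsCDS W D × ∣ D ∣ ≡ k))
    × (∀ D → IsCDS W D → k ≤ ∣ D ∣)

  γc< : Subset n → ℕ → Set
  γc< W k = ∃[ D ] (IsCDS W D × ∣ D ∣ < k)

  minusV : Fin n → Subset n
  minusV v = ∁ ⁅ v ⁆

  VertexCritical : ℕ → Set
  VertexCritical k = γc≡ ⊤ k × (∀ v → γc< (minusV v) k)

  Connected : Set
  Connected = ConnectedOn ⊤

  TwoConnected : Set
  TwoConnected = 2 < n × Connected × (∀ v → ConnectedOn (minusV v))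

  ClawFree : Set
  ClawFree = ∀ a b c d → Adj G a b → Adj G a c → Adj G a d →
    b ≢ c → b ≢ d → c ≢ d →
    ¬ (¬ Adj G b c × ¬ Adj G b d × ¬ Adj G c d)

  data Chain : List (Fin n) → Set where
    nil  : Chain []
    one  : ∀ x → Chain (x ∷ [])
    cons : ∀ x y xs → Adj G x y → Chain (y ∷ xs) → Chain (x ∷ y ∷ xs)

  Hamiltonian : Set
  Hamiltonian = Σ (Fin n) λ x₀ → Σ (List (Fin n)) λ xs → Σ (Fin n) λ xₘ →
    Chain (x₀ ∷ xs Data.List.++ (xₘ ∷ []))
    × Unique (x₀ ∷ xs Data.List.++ (xₘ ∷ []))
    × (∀ v → v LM.∈ (x₀ ∷ xs Data.List.++ (xₘ ∷ [])))
    × 3 ≤ length (x₀ ∷ xs Data.List.++ (xₘ ∷ []))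
    × Adj G xₘ x₀

{-# OPTIONS --safe #-}

-- By criticality, G − v has a connected dominating set of at most two vertices for each vertex
-- v.  Let K be a longest cycle missing a vertex u, let H be the component of u in G − K, and
-- call a vertex attached if it has a neighbour in H.  No path through exactly the vertices of K
-- joins two attached vertices of K, for otherwise a detour through H gives a longer cycle.
--
-- Take h₁ attached on K and dominate G − h₁ by D.  Since H cannot dominate the successor of h₁
-- on K, D contains an attached vertex h₂ of K.  Write K = h₁ P h₂ Q with P = p₁ … pₖ and
-- Q = q₁ … qₗ.  Claws centred at h₂ show that h₂ is adjacent to neither p₁ nor qₗ, so a second
-- vertex y of D is adjacent to p₁, qₗ and h₂.  If y is not on K there is a claw at h₂; if y
-- lies on P with predecessor z, then claw-freeness at y makes z adjacent to qₗ or to h₂, and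
-- either edge yields a forbidden path from h₂ to h₁.  Reversing K handles y on Q.
--
-- The existence of a longest cycle is classical; it is harmless because being Hamiltonian is
-- decidable.
module Submission where

open import Defs
open import Data.Nat using (ℕ; zero; suc; _+_; _≤_; _<_; z≤n; s≤s)
import Data.Nat.Properties as ℕ
open import Data.Fin using (Fin; zero; suc) renaming (_≟_ to _≟ᶠ_)
open import Data.Fin.Properties using (any?; all?; ¬∀⟶∃¬; injective⇒≤)
open import Data.Fin.Subset using (Subset; ⊤; _-_; ∣_∣) renaming (_∈_ to _∈ˢ_)
import Data.Fin.Subset.Properties as Subset
open import Data.List using (List; []; _∷_; _++_; length; lookup)
open import Data.List.Properties using (length-++)
open import Data.List.Relation.Unary.All as All using (All; []; _∷_)
import Data.List.Relation.Unary.All.Properties as All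
open import Data.List.Relation.Unary.Any as Any using (here; there)
open import Data.List.Relation.Unary.AllPairs using ([]; _∷_)
open import Data.List.Relation.Unary.Unique.Propositional using (Unique)
open import Data.List.Relation.Unary.Unique.Propositional.Properties using (++⁺)
open import Data.List.Relation.Binary.Subset.Propositional using (_⊆_)
open import Data.List.Relation.Binary.Permutation.Propositional
  using (_↭_; ↭-refl; ↭-sym; ↭-trans; ↭-prep; ↭⇒↭ₛ)
open import Data.List.Relation.Binary.Permutation.Propositional.Properties
  using (++-comm; shift; ∈-resp-↭; ↭-length; ++-commutativeMonoid)
  renaming (++⁺ to ↭-++; ++⁺ʳ to ↭-++ʳ; ++⁺ˡ to ↭-++ˡ)
open import Data.List.Membership.Propositional using (_∈_; _∉_)
open import Data.List.Membership.Propositional.Properties using (∈-++⁺ˡ; ∈-++⁺ʳ; ∈-++⁻; ∈-lookup)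
open import Data.List.Membership.Setoid.Properties using (index-injective)
open import Data.Product using (Σ; _×_; ∃-syntax; _,_; proj₁; proj₂)
open import Data.Sum using (_⊎_; inj₁; inj₂)
open import Data.Empty using (⊥; ⊥-elim)
open import Function using (_∘_)
open import Relation.Nullary using (¬_; Dec; yes; no; contradiction)
open import Relation.Nullary.Decidable using (_×-dec_; map′; decidable-stable)
open import Relation.Binary.PropositionalEquality using (_≡_; _≢_; refl; cong; subst; ≢-sym)
  renaming (sym to ≡-sym)
open import Relation.Binary.PropositionalEquality.Properties using (setoid)
import Algebra.Solver.CommutativeMonoid as CommutativeMonoidSolver
open import Data.List.Relation.Unary.Unique.DecPropositional using (unique?)
import Data.List.Membership.DecPropositional as DecMembership

private
  variable
    n : ℕ
    A : Set

-- Lists without repetition and counting.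

unique-resp-↭ : {l m : List A} → l ↭ m → Unique l → Unique m
unique-resp-↭ {A = A} l↭m =
  AllPairs-resp-↭ ≢-sym ((λ { refl p → p }) , (λ { refl p → p })) (↭⇒↭ₛ l↭m)
  where open import Data.List.Relation.Binary.Permutation.Setoid.Properties (setoid A)
          using (AllPairs-resp-↭)

unique-++-≢ : (l : List A) {m : List A} {x y : A} → Unique (l ++ m) → x ∈ l → y ∈ m → x ≢ y
unique-++-≢ (_ ∷ l) (z≢ ∷ _) (here refl) y∈m = All.lookup z≢ (∈-++⁺ʳ l y∈m)
unique-++-≢ (_ ∷ l) (_ ∷ u) (there x∈l) y∈m = unique-++-≢ l u x∈l y∈m

lookup-injective : {l : List A} → Unique l → ∀ i j → lookup l i ≡ lookup l j → i ≡ j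
lookup-injective {l = _ ∷ _} _ zero zero _ = refl
lookup-injective {l = _ ∷ l} (x≢ ∷ _) zero (suc j) eq = contradiction eq (All.lookup x≢ (∈-lookup j))
lookup-injective {l = _ ∷ l} (x≢ ∷ _) (suc i) zero eq = contradiction (≡-sym eq) (All.lookup x≢ (∈-lookup i))
lookup-injective {l = _ ∷ _} (_ ∷ u) (suc i) (suc j) eq = cong suc (lookup-injective u i j eq)

unique⇒length≤n : {l : List (Fin n)} → Unique l → length l ≤ n
unique⇒length≤n u = injective⇒≤ (λ {i} {j} → lookup-injective u i j)

covering⇒n≤length : {l : List (Fin n)} → (∀ v → v ∈ l) → n ≤ length l
covering⇒n≤length {l = l} cover = injective⇒≤ {f = λ v → Any.index (cover v)}
  (λ {v} {w} → index-injective (setoid _) (cover v) (cover w))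

3≤∣p∣ : {p : Subset n} {x y z : Fin n} → x ∈ˢ p → y ∈ˢ p → z ∈ˢ p →
        x ≢ y → z ≢ x → z ≢ y → 3 ≤ ∣ p ∣
3≤∣p∣ {p = p} {x} {y} {z} x∈p y∈p z∈p x≢y z≢x z≢y =
  ℕ.≤-trans (s≤s (ℕ.≤-trans (s≤s (ℕ.≤-trans (s≤s z≤n)
    (Subset.x∈p⇒∣p-x∣<∣p∣ z∈p-x-y))) (Subset.x∈p⇒∣p-x∣<∣p∣ y∈p-x)))
    (Subset.x∈p⇒∣p-x∣<∣p∣ x∈p)
  where
  y∈p-x : y ∈ˢ p - x
  y∈p-x = Subset.x∈p∧x≢y⇒x∈p-y y∈p (≢-sym x≢y)
  z∈p-x-y : z ∈ˢ p - x - y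
  z∈p-x-y = Subset.x∈p∧x≢y⇒x∈p-y (Subset.x∈p∧x≢y⇒x∈p-y z∈p z≢x) z≢y

-- Deciding Hamiltonicity by bounded search.

boundedList? : {P : List (Fin n) → Set} → (∀ l → Dec (P l)) →
               ∀ k → Dec (∃[ l ] (length l ≤ k × P l))
boundedList? P? zero = map′ (λ p → [] , z≤n , p) (λ { ([] , _ , p) → p }) (P? [])
boundedList? P? (suc k) with P? []
... | yes p = yes ([] , z≤n , p)
... | no ¬p = map′
  (λ { (x , l , l≤k , p) → x ∷ l , s≤s l≤k , p })
  (λ { ([] , _ , p) → contradiction p ¬p ; (x ∷ l , s≤s l≤k , p) → x , l , l≤k , p })
  (any? (λ x → boundedList? (λ l → P? (x ∷ l)) k))

module _ {n : ℕ} (G : Graph n) where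

  open DecMembership (_≟ᶠ_ {n}) using (_∈?_)

  chain? : ∀ l → Dec (Chain G l)
  chain? [] = yes nil
  chain? (x ∷ []) = yes (one x)
  chain? (x ∷ y ∷ l) = map′ (λ { (e , c) → cons x y l e c }) (λ { (cons _ _ _ e c) → e , c })
    (dec G x y ×-dec chain? (y ∷ l))

  -- A list of distinct vertices has at most `n` entries, so only finitely many candidates for the
  -- interior of the cycle need testing.
  hamiltonian? : Dec (Hamiltonian G)
  hamiltonian? = map′
    (λ { (x , z , l , _ , h) → x , l , z , h })
    (λ { (x , l , z , h) → x , z , l , bound x l z (proj₁ (proj₂ h)) , h })
    (any? λ x → any? λ z → boundedList? (λ l → let m = x ∷ l ++ z ∷ [] in
      chain? m ×-dec unique? _≟ᶠ_ m ×-dec all? (_∈? m) ×-dec (3 ℕ.≤? length m) ×-dec dec G z x) n)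
    where
    bound : ∀ x l z → Unique (x ∷ l ++ z ∷ []) → length l ≤ n
    bound x l z u = ℕ.≤-trans (ℕ.m≤n⇒m≤1+n (ℕ.m≤m+n (length l) 1))
      (subst (λ k → suc k ≤ n) (length-++ l) (unique⇒length≤n u))

-- Paths and their rearrangement.

module Paths {n : ℕ} (G : Graph n) where

  open DecMembership (_≟ᶠ_ {n}) using (_∈?_)

  V : Set
  V = Fin n

  data Seg : V → List V → V → Set where
    [_]  : ∀ a → Seg a (a ∷ []) a
    _∷_ : ∀ {a b c l} → Adj G a b → Seg b l c → Seg a (a ∷ l) c

  private
    variable
      a b c d y : V
      l m : List V

  Seg-start∈ : Seg a l b → a ∈ l
  Seg-start∈ [ _ ] = here refl
  Seg-start∈ (_ ∷ _) = here refl

  Seg-end∈ : Seg a l b → b ∈ l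
  Seg-end∈ [ _ ] = here refl
  Seg-end∈ (_ ∷ s) = there (Seg-end∈ s)

  Seg-++ : Seg a l b → Adj G b c → Seg c m d → Seg a (l ++ m) d
  Seg-++ [ _ ] e t = e ∷ t
  Seg-++ (f ∷ s) e t = f ∷ Seg-++ s e t

  SimplePathIn : V → List V → V → Set
  SimplePathIn a l b = ∃[ m ] (Seg a m b × Unique m × m ⊆ l)

  Seg-suffix : Seg a l b → Unique l → y ∈ l → SimplePathIn y l b
  Seg-suffix s u (here refl) with s
  ... | [ _ ] = _ , s , u , λ z → z
  ... | _ ∷ _ = _ , s , u , λ z → z
  Seg-suffix (_ ∷ s) (_ ∷ u) (there y∈l) with Seg-suffix s u y∈l
  ... | m , t , um , m⊆l = m , t , um , there ∘ m⊆l

  -- If `a` already lies on the path from `b`, the suffix starting at `a` is taken instead of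
  -- prepending `a`.
  simple-∷ : Adj G a b → SimplePathIn b l c → SimplePathIn a (a ∷ l) c
  simple-∷ {a = a} e (m , s , u , m⊆l) with a ∈? m
  ... | yes a∈m = let m′ , t , u′ , m′⊆m = Seg-suffix s u a∈m in m′ , t , u′ , there ∘ m⊆l ∘ m′⊆m
  ... | no a∉m = a ∷ m , e ∷ s , (All.tabulate (λ { z∈m refl → a∉m z∈m }) ∷ u) ,
    λ { (here p) → here p ; (there p) → there (m⊆l p) }

  eraseLoops : Seg a l b → SimplePathIn a l b
  eraseLoops [ a ] = _ , [ a ] , ([] ∷ []) , λ z → z
  eraseLoops (e ∷ s) = simple-∷ e (eraseLoops s)

  Seg-chain : Seg a l b → Chain G l
  Seg-chain [ a ] = one a
  Seg-chain (e ∷ [ b ]) = cons _ _ _ e (one b)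
  Seg-chain (e ∷ s@(_ ∷ _)) = cons _ _ _ e (Seg-chain s)

  Seg-snoc : Adj G a b → Seg b l c → ∃[ xs ] l ≡ xs ++ c ∷ []
  Seg-snoc _ [ _ ] = [] , refl
  Seg-snoc _ (e ∷ s) with Seg-snoc e s
  ... | xs , refl = _ ∷ xs , refl

  -- Vertices are recorded only up to permutation, so that checking which vertices a rerouted cycle
  -- uses becomes an identity in a commutative monoid.
  Path : V → List V → V → Set
  Path a l b = ∃[ m ] (Seg a m b × m ↭ l)

  resp : l ↭ m → Path a l b → Path a m b
  resp l↭m (_ , s , p) = _ , s , ↭-trans p l↭m

  single : ∀ a → Path a (a ∷ []) a
  single a = _ , [ a ] , ↭-refl

  join : Path a l b → Adj G b c → Path c m d → Path a (l ++ m) d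
  join (_ , s , p) e (_ , t , q) = _ , Seg-++ s e t , ↭-++ p q

  rev : Path a l b → Path b l a
  rev (_ , s , p) = resp p (Seg-rev s)
    where
    Seg-rev : Seg a l b → Path b l a
    Seg-rev [ a ] = single a
    Seg-rev {l = a ∷ l} (e ∷ s) = resp (++-comm l (a ∷ [])) (join (Seg-rev s) (sym G e) (single a))

  start∈ : Path a l b → a ∈ l
  start∈ (_ , s , p) = ∈-resp-↭ p (Seg-start∈ s)

  end∈ : Path a l b → b ∈ l
  end∈ (_ , s , p) = ∈-resp-↭ p (Seg-end∈ s)

  data Split (a : V) (l : List V) (b y : V) : Set where
    split : ∀ {l₁ l₂ z} → Path a l₁ z → Adj G z y → Path y l₂ b → l ↭ l₁ ++ l₂ → Split a l b y

  splitAt : Path a l b → y ∈ l → y ≡ a ⊎ Split a l b y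
  splitAt (_ , s , p) y∈l = Seg-split s p (∈-resp-↭ (↭-sym p) y∈l)
    where
    Seg-split : ∀ {a l m b y} → Seg a m b → m ↭ l → y ∈ m → y ≡ a ⊎ Split a l b y
    Seg-split [ _ ] p (here eq) = inj₁ eq
    Seg-split (e ∷ s) p (here eq) = inj₁ eq
    Seg-split {a = a} (e ∷ s) p (there y∈m) with Seg-split s ↭-refl y∈m
    ... | inj₁ refl = inj₂ (split (single a) e (_ , s , ↭-refl) (↭-sym p))
    ... | inj₂ (split s₁ f s₂ q) =
      inj₂ (split (join (single a) e s₁) f s₂ (↭-trans (↭-sym p) (↭-prep a q)))

  uncons : Path a l b → a ≡ b ⊎ ∃[ c ] ∃[ m ] (Adj G a c × Path c m b × l ↭ a ∷ m)
  uncons (_ , [ _ ] , p) = inj₁ refl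
  uncons (_ , e ∷ s , p) = inj₂ (_ , _ , e , (_ , s , ↭-refl) , ↭-sym p)

-- Detours around a longest cycle.

module Extension {n : ℕ} (G : Graph n) (clawFree : ClawFree G) where

  open Paths G
  open DecMembership (_≟ᶠ_ {n}) using (_∈?_)
  open CommutativeMonoidSolver (++-commutativeMonoid {A = V}) using (solve; _⊕_; _⊜_)

  claw : ∀ {a b c d} → Adj G a b → Adj G a c → Adj G a d → b ≢ c → b ≢ d → c ≢ d →
         ¬ Adj G b c → ¬ Adj G b d → ¬ Adj G c d → ⊥
  claw ab ac ad b≢c b≢d c≢d ¬bc ¬bd ¬cd = clawFree _ _ _ _ ab ac ad b≢c b≢d c≢d (¬bc , ¬bd , ¬cd)

  module Maximal (K : List V) (uniqueK : Unique K)
    (maximal : ∀ {a b l} → Seg a l b → Adj G b a → Unique l → length K < length l → ⊥) where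

    -- Both ends avoid `K` as well, so for `w` off `K` this is the component of `w` in the graph
    -- without `K`.
    Reach : V → V → Set
    Reach w w′ = ∃[ R ] (Seg w R w′ × All (_∉ K) R)

    Reach-step : ∀ {w w′ z} → Reach w w′ → Adj G w′ z → z ∉ K → Reach w z
    Reach-step (_ , s , o) e z∉K = _ , Seg-++ s e [ _ ] , All.++⁺ o (z∉K ∷ [])

    -- The walk to `w` is reversed, edge by edge, onto the front of the walk to `w′`.
    Reach-trans : ∀ {u w w′} → Reach u w → Reach u w′ → Reach w w′
    Reach-trans (_ , [ _ ] , _) r = r
    Reach-trans {u} (_ , e ∷ s , u∉K ∷ o) (_ , t , o′) =
      Reach-trans (_ , s , o) (_ , sym G e ∷ t , start∉ s o ∷ o′)
      where
      start∉ : ∀ {a l b} → Seg a l b → All (_∉ K) l → a ∉ K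
      start∉ s o = All.lookup o (Seg-start∈ s)

    -- The outside walk, with loops erased, closes the path to a cycle through `K` and at least one
    -- more vertex; this holds even when `w` and `w′` coincide.
    noDetour : ∀ {a b l w w′} → Path a l b → l ↭ K → Adj G a w → Adj G b w′ → Reach w w′ → ⊥
    noDetour {l = l} p l↭K aw bw′ (R , s , o)
      with eraseLoops s
    ... | R′ , s′ , uR′ , R′⊆R with join (_ , s′ , ↭-refl) (sym G bw′) (rev p)
    ...   | m , t , m↭ = maximal t aw (unique-resp-↭ (↭-sym m↭) unique) longer
      where
      unique : Unique (R′ ++ l)
      unique = ++⁺ uR′ (unique-resp-↭ (↭-sym l↭K) uniqueK)
        (λ (x∈R′ , x∈l) → All.lookup o (R′⊆R x∈R′) (∈-resp-↭ l↭K x∈l))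
      nonempty : ∀ {a l b} → Seg a l b → 1 ≤ length l
      nonempty [ _ ] = s≤s z≤n
      nonempty (_ ∷ _) = s≤s z≤n
      longer : length K < length m
      longer rewrite ↭-length m↭ | length-++ R′ {l} | ↭-length l↭K = ℕ.+-monoˡ-≤ (length K) (nonempty s′)

    -- The cyclic order is h₁ P h₂ Q. Both arcs are non-empty, because a `Path` has at least one
    -- vertex.
    record Config (h₁ h₂ : V) : Set where
      field
        {P Q} : List V
        {p₁ pₖ q₁ qₗ} : V
        pathP : Path p₁ P pₖ
        pathQ : Path q₁ Q qₗ
        h₁p₁ : Adj G h₁ p₁
        pₖh₂ : Adj G pₖ h₂
        h₂q₁ : Adj G h₂ q₁
        qₗh₁ : Adj G qₗ h₁
        perm : h₁ ∷ h₂ ∷ P ++ Q ↭ K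

    -- Reading the cycle backwards exchanges p₁ with qₗ and pₖ with q₁. Together with `swapEnds`
    -- this carries a fact about one cycle neighbour of h₁ or h₂ to all four.
    flip : ∀ {h₁ h₂} → Config h₁ h₂ → Config h₁ h₂
    flip c = record
      { pathP = rev pathQ ; pathQ = rev pathP
      ; h₁p₁ = sym G qₗh₁ ; pₖh₂ = sym G h₂q₁ ; h₂q₁ = sym G pₖh₂ ; qₗh₁ = sym G h₁p₁
      ; perm = ↭-trans (↭-prep _ (↭-prep _ (++-comm Q P))) perm }
      where open Config c

    swapEnds : ∀ {h₁ h₂} → Config h₁ h₂ → Config h₂ h₁
    swapEnds {h₁} {h₂} c = record
      { pathP = pathQ ; pathQ = pathP
      ; h₁p₁ = h₂q₁ ; pₖh₂ = qₗh₁ ; h₂q₁ = h₁p₁ ; qₗh₁ = pₖh₂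
      ; perm = ↭-trans (solve 4 (λ a b p q → b ⊕ a ⊕ q ⊕ p ⊜ a ⊕ b ⊕ p ⊕ q) ↭-refl
                 (h₁ ∷ []) (h₂ ∷ []) P Q) perm }
      where open Config c

    -- Claws and forbidden paths at attached vertices.

    module Component (u : V) where

      H : V → Set
      H = Reach u

      H⇒∉K : ∀ {w} → H w → w ∉ K
      H⇒∉K (_ , s , o) = All.lookup o (Seg-end∈ s)

      Attached : V → Set
      Attached c = ∃[ w ] (H w × Adj G c w)

      noPath : ∀ {a b l} → Path a l b → l ↭ K → Attached a → Attached b → ⊥
      noPath p l↭K (_ , Hw , aw) (_ , Hw′ , bw′) = noDetour p l↭K aw bw′ (Reach-trans Hw Hw′)

      ¬Attached⇒¬Adj : ∀ {c w} → ¬ Attached c → H w → ¬ Adj G c w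
      ¬Attached⇒¬Adj ¬att Hw cw = ¬att (_ , Hw , cw)

      module Facts {h₁ h₂} (c : Config h₁ h₂) (att₁ : Attached h₁) where
        open Config c

        path-h₁…qₗ : Path h₁ (h₁ ∷ P ++ h₂ ∷ Q) qₗ
        path-h₁…qₗ = join (single h₁) h₁p₁ (join pathP pₖh₂ (join (single h₂) h₂q₁ pathQ))

        path↭K : h₁ ∷ P ++ h₂ ∷ Q ↭ K
        path↭K = ↭-trans (solve 4 (λ a b p q → a ⊕ p ⊕ b ⊕ q ⊜ a ⊕ b ⊕ p ⊕ q) ↭-refl
          (h₁ ∷ []) (h₂ ∷ []) P Q) perm

        ¬att-qₗ : ¬ Attached qₗ
        ¬att-qₗ = noPath path-h₁…qₗ path↭K att₁

        -- The edge would give the path h₁ qₗ ... q₁ p₁ ... pₖ h₂ through all of `K`.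
        p₁≁q₁ : Attached h₂ → ¬ Adj G p₁ q₁
        p₁≁q₁ att₂ p₁q₁ = noPath (join (single h₁) (sym G qₗh₁) (join (rev pathQ) (sym G p₁q₁) (join pathP pₖh₂ (single h₂))))
          (↭-trans (solve 4 (λ a b p q → a ⊕ q ⊕ p ⊕ b ⊜ a ⊕ b ⊕ p ⊕ q) ↭-refl
                 (h₁ ∷ []) (h₂ ∷ []) P Q) perm) att₁ att₂

        P⊆K : ∀ {x} → x ∈ P → x ∈ K
        P⊆K x∈P = ∈-resp-↭ perm (there (there (∈-++⁺ˡ x∈P)))

        P≢Q : ∀ {x y} → x ∈ P → y ∈ Q → x ≢ y
        P≢Q with unique-resp-↭ (↭-sym perm) uniqueK
        ... | _ ∷ _ ∷ uPQ = unique-++-≢ P uPQ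

        P≢h₂ : ∀ {x} → x ∈ P → x ≢ h₂
        P≢h₂ x∈P with unique-resp-↭ (↭-sym perm) uniqueK
        ... | _ ∷ h₂≢ ∷ _ = ≢-sym (All.lookup h₂≢ (∈-++⁺ˡ x∈P))

        H≢P : ∀ {w x} → H w → x ∈ P → x ≢ w
        H≢P Hw x∈P refl = H⇒∉K Hw (P⊆K x∈P)

      module Facts₂ {h₁ h₂} (c : Config h₁ h₂) (att₁ : Attached h₁) (att₂ : Attached h₂) where
        open Config c
        open Facts c att₁ using (p₁≁q₁; P⊆K; P≢Q; P≢h₂; H≢P; ¬att-qₗ)
        private
          module Rev = Facts (flip c) att₁
          module Swap = Facts (swapEnds c) att₂
          module SwapRev = Facts (flip (swapEnds c)) att₂
          w₂ : V
          w₂ = proj₁ att₂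
          Hw₂ : H w₂
          Hw₂ = proj₁ (proj₂ att₂)
          h₂w₂ : Adj G h₂ w₂
          h₂w₂ = proj₂ (proj₂ att₂)

        ¬att-p₁ : ¬ Attached p₁
        ¬att-p₁ = Rev.¬att-qₗ
        ¬att-pₖ : ¬ Attached pₖ
        ¬att-pₖ = Swap.¬att-qₗ
        ¬att-q₁ : ¬ Attached q₁
        ¬att-q₁ = SwapRev.¬att-qₗ

        -- Otherwise p₁, q₁ and w₂ are the leaves of a claw at h₂.
        h₂≁p₁ : ¬ Adj G h₂ p₁
        h₂≁p₁ h₂p₁ = claw h₂p₁ h₂q₁ h₂w₂
          (P≢Q (start∈ pathP) (start∈ pathQ)) (H≢P Hw₂ (start∈ pathP)) (Rev.H≢P Hw₂ (start∈ pathQ))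
          (p₁≁q₁ att₂) (¬Attached⇒¬Adj ¬att-p₁ Hw₂) (¬Attached⇒¬Adj ¬att-q₁ Hw₂)

        -- The neighbour w₂ in `H` is adjacent to neither vertex, so it would be the third leaf of a
        -- claw at h₂.
        h₂-clique : ∀ {x y} → Adj G h₂ x → Adj G h₂ y → x ≢ y → x ∈ K → y ∈ K →
                    ¬ Attached x → ¬ Attached y → Adj G x y
        h₂-clique {x} {y} h₂x h₂y x≢y x∈K y∈K ¬attx ¬atty with dec G x y
        ... | yes xy = xy
        ... | no ¬xy = ⊥-elim (claw h₂x h₂y h₂w₂ x≢y (K≢w x∈K) (K≢w y∈K)
                ¬xy (¬Attached⇒¬Adj ¬attx Hw₂) (¬Attached⇒¬Adj ¬atty Hw₂))
          where
          K≢w : ∀ {z} → z ∈ K → z ≢ w₂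
          K≢w z∈K refl = H⇒∉K Hw₂ z∈K

        pₖq₁ : Adj G pₖ q₁
        pₖq₁ = h₂-clique (sym G pₖh₂) h₂q₁ (P≢Q (end∈ pathP) (start∈ pathQ))
          (P⊆K (end∈ pathP)) (Rev.P⊆K (start∈ pathQ)) ¬att-pₖ ¬att-q₁

        noneInP : ∀ {y} → ¬ Adj G h₂ qₗ → y ∈ P →
                  Adj G h₂ y → Adj G y p₁ → Adj G y qₗ → ⊥
        noneInP {y} h₂≁qₗ y∈P h₂y yp₁ yqₗ with splitAt pathP y∈P
        ... | inj₁ refl = irr G yp₁
        ... | inj₂ (split {P₁} {P₂} {z} path₁ zy path₂ P↭) with dec G z qₗ | dec G z h₂
        -- The path is h₂ pₖ ... y q₁ ... qₗ z ... p₁ h₁. Its edge from y to q₁ exists because y is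
        -- unattached, by the path y ... pₖ h₂ q₁ ... qₗ z ... p₁ h₁.
        ...   | yes zqₗ | _ = noPath
          (join (single h₂) (sym G pₖh₂) (join (rev path₂) yq₁ (join pathQ (sym G zqₗ) (join (rev path₁) (sym G h₁p₁) (single h₁)))))
          (↭-trans (solve 5 (λ a b p p′ q → b ⊕ p′ ⊕ q ⊕ p ⊕ a ⊜ a ⊕ b ⊕ (p ⊕ p′) ⊕ q) ↭-refl
            (h₁ ∷ []) (h₂ ∷ []) P₁ P₂ Q) permP) att₂ att₁
          where
          permP : h₁ ∷ h₂ ∷ (P₁ ++ P₂) ++ Q ↭ K
          permP = ↭-trans (↭-prep _ (↭-prep _ (↭-++ʳ Q (↭-sym P↭)))) perm
          ¬att-y : ¬ Attached y
          ¬att-y atty = noPath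
            (join path₂ pₖh₂ (join (single h₂) h₂q₁ (join pathQ (sym G zqₗ) (join (rev path₁) (sym G h₁p₁) (single h₁)))))
            (↭-trans (solve 5 (λ a b p p′ q → p′ ⊕ b ⊕ q ⊕ p ⊕ a ⊜ a ⊕ b ⊕ (p ⊕ p′) ⊕ q) ↭-refl
              (h₁ ∷ []) (h₂ ∷ []) P₁ P₂ Q) permP) atty att₁
          yq₁ : Adj G y q₁
          yq₁ = h₂-clique h₂y h₂q₁ (P≢Q y∈P (start∈ pathQ)) (P⊆K y∈P) (Rev.P⊆K (start∈ pathQ)) ¬att-y ¬att-q₁
        -- The path is h₂ z ... p₁ y ... pₖ q₁ ... qₗ h₁.
        ...   | no _ | yes zh₂ = noPath
          (join (single h₂) (sym G zh₂) (join (rev path₁) (sym G yp₁) (join path₂ pₖq₁ (join pathQ qₗh₁ (single h₁)))))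
          (↭-trans (solve 5 (λ a b p p′ q → b ⊕ p ⊕ p′ ⊕ q ⊕ a ⊜ a ⊕ b ⊕ (p ⊕ p′) ⊕ q) ↭-refl
            (h₁ ∷ []) (h₂ ∷ []) P₁ P₂ Q)
            (↭-trans (↭-prep _ (↭-prep _ (↭-++ʳ Q (↭-sym P↭)))) perm)) att₂ att₁
        -- The claw is centred at y, with leaves z, qₗ and h₂.
        ...   | no ¬zqₗ | no ¬zh₂ = claw (sym G zy) yqₗ (sym G h₂y)
          (P≢Q z∈P (end∈ pathQ)) (P≢h₂ z∈P) (Rev.P≢h₂ (end∈ pathQ))
          ¬zqₗ ¬zh₂ (h₂≁qₗ ∘ sym G)
          where
          z∈P : z ∈ P
          z∈P = ∈-resp-↭ (↭-sym P↭) (∈-++⁺ˡ (end∈ path₁))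

        -- The claw at h₂ has leaves y, w₂ and pₖ: y is not in `H`, since p₁ is unattached, and an
        -- edge from y to pₖ would let y be inserted between h₂ and pₖ.
        outside : ∀ {y} → y ∉ K → Adj G h₂ y → Adj G y p₁ → ⊥
        outside {y} y∉K h₂y yp₁ = claw h₂y h₂w₂ (sym G pₖh₂)
          (λ { refl → ¬Hy Hw₂ }) (λ { refl → y∉K (P⊆K (end∈ pathP)) }) (≢-sym (H≢P Hw₂ (end∈ pathP)))
          (λ yw₂ → ¬Hy (Reach-step Hw₂ (sym G yw₂) y∉K))
          (λ ypₖ → noDetour Swap.path-h₁…qₗ Swap.path↭K h₂y (sym G ypₖ) (_ , [ y ] , y∉K ∷ []))
          (λ w₂pₖ → ¬att-pₖ (_ , Hw₂ , sym G w₂pₖ))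
          where
          ¬Hy : ¬ H y
          ¬Hy Hy = ¬att-p₁ (_ , Hy , sym G yp₁)

      noDominatingPair : ∀ {h₁ h₂ y} (c : Config h₁ h₂) → Attached h₁ → Attached h₂ → y ≢ h₁ →
        let open Config c in Adj G h₂ y → Adj G y p₁ → Adj G y qₗ → ⊥
      noDominatingPair {h₁} {h₂} {y} c att₁ att₂ y≢h₁ h₂y yp₁ yqₗ with y ∈? K
      ... | no y∉K = Facts₂.outside c att₁ att₂ y∉K h₂y yp₁
      ... | yes y∈K with ∈-resp-↭ (↭-sym (Config.perm c)) y∈K
      ...   | here y≡h₁ = y≢h₁ y≡h₁
      ...   | there (here refl) = irr G h₂y
      ...   | there (there y∈P++Q) with ∈-++⁻ (Config.P c) y∈P++Q
      ...     | inj₁ y∈P = Facts₂.noneInP c att₁ att₂ (Facts₂.h₂≁p₁ (flip c) att₁ att₂) y∈P h₂y yp₁ yqₗ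
      ...     | inj₂ y∈Q = Facts₂.noneInP (flip c) att₁ att₂ (Facts₂.h₂≁p₁ c att₁ att₂) y∈Q h₂y yqₗ yp₁

  -- Connected dominating sets with at most two vertices.

  module SmallCDS {h₁ : V} {D : Subset n} (cds : IsCDS G (minusV G h₁) D) (∣D∣<3 : ∣ D ∣ < 3) where

    D≢h₁ : ∀ {x} → x ∈ˢ D → x ≢ h₁
    D≢h₁ x∈D refl = Subset.x∈∁p⇒x∉p (proj₁ cds x∈D) (Subset.x∈⁅x⁆ _)

    atMostTwo : ∀ {x y z} → x ∈ˢ D → y ∈ˢ D → z ∈ˢ D → x ≢ y → z ≢ x → z ≡ y
    atMostTwo {x} {y} {z} x∈D y∈D z∈D x≢y z≢x with z ≟ᶠ y
    ... | yes z≡y = z≡y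
    ... | no z≢y = contradiction (3≤∣p∣ x∈D y∈D z∈D x≢y z≢x z≢y) (ℕ.<⇒≱ ∣D∣<3)

    -- A walk inside `D` leaves `x` for a different vertex of `D`, which can only be `y`.
    D-adj : ∀ {x y} → x ∈ˢ D → y ∈ˢ D → x ≢ y → Adj G x y
    D-adj {x} {y} x∈D y∈D x≢y with proj₂ (proj₂ cds) x y x∈D y∈D
    ... | here _ = contradiction refl x≢y
    ... | step _ xz walk = subst (Adj G x)
      (atMostTwo x∈D y∈D (walkStart walk) x≢y (λ { refl → irr G xz })) xz
      where
      walkStart : ∀ {S z y} → WalkIn G S z y → z ∈ˢ S
      walkStart (here z∈S) = z∈S
      walkStart (step z∈S _ _) = z∈S

    dominated : ∀ {w} → w ≢ h₁ → ∃[ z ] (z ∈ˢ D × (z ≡ w ⊎ Adj G z w))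
    dominated {w} w≢h₁ with w Subset.∈? D
    ... | yes w∈D = w , w∈D , inj₁ refl
    ... | no w∉D with proj₁ (proj₂ cds) w (Subset.x∉p⇒x∈∁p (Subset.x≢y⇒x∉⁅y⁆ w≢h₁)) w∉D
    ...   | z , z∈D , wz = z , z∈D , inj₂ (sym G wz)

  -- Criticality against a longest cycle.

  module _ (connected : Connected G) (critical : ∀ v → γc< G (minusV G v) 3) where

    noMaximalCycle : ∀ {a l b u} → Seg a l b → Adj G b a → (uniqueL : Unique l) → u ∉ l →
      (∀ {a b m} → Seg a m b → Adj G b a → Unique m → length l < length m → ⊥) → ⊥
    noMaximalCycle {a} {K} {b} {u} cycle ba uniqueK u∉K maximal =
      let h₁ , h₁∈K , att₁ = firstAttached (_ , [ u ] , u∉K ∷ []) (connected u a Subset.∈⊤ Subset.∈⊤) (Seg-start∈ cycle)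
          qₗ , pathK , qₗh₁ = rotate h₁∈K
      in extendAt att₁ pathK qₗh₁ (critical h₁)
      where
      open Maximal K uniqueK maximal
      open Component u

      -- The walk stays in `H` until it first meets `K`, so the vertex met there is attached.
      firstAttached : ∀ {w z} → H w → WalkIn G ⊤ w z → z ∈ K → ∃[ h ] (h ∈ K × Attached h)
      firstAttached Hw (here _) z∈K = contradiction z∈K (H⇒∉K Hw)
      firstAttached Hw (step {y = y} _ wy walk) z∈K with y ∈? K
      ... | yes y∈K = y , y∈K , _ , Hw , sym G wy
      ... | no y∉K = firstAttached (Reach-step Hw wy y∉K) walk z∈K

      rotate : ∀ {h} → h ∈ K → ∃[ q ] (Path h K q × Adj G q h)
      rotate h∈K with splitAt (_ , cycle , ↭-refl) h∈K
      ... | inj₁ refl = b , (_ , cycle , ↭-refl) , ba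
      ... | inj₂ (split {l₁} {l₂} p e q K↭) = _ , resp (↭-trans (++-comm l₂ l₁) (↭-sym K↭)) (join q ba p) , e

      extendAt : ∀ {h₁ qₗ} → Attached h₁ → Path h₁ K qₗ → Adj G qₗ h₁ → γc< G (minusV G h₁) 3 → ⊥
      extendAt {h₁} {qₗ} att₁ pathK qₗh₁ (D , cds , ∣D∣<3) with uncons pathK
      ... | inj₁ refl = irr G qₗh₁
      ... | inj₂ (p₁ , K′ , h₁p₁ , pathK′ , K↭) = impossible
        where
        open SmallCDS cds ∣D∣<3

        ¬att-p₁ : ¬ Attached p₁
        ¬att-p₁ att = noPath (join pathK′ qₗh₁ (single h₁)) (↭-trans (++-comm K′ _) (↭-sym K↭)) att att₁

        ¬att-qₗ : ¬ Attached qₗ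
        ¬att-qₗ = noPath pathK ↭-refl att₁

        -- Neither arc is empty, since p₁ and qₗ are unattached and thus differ from h₂. The two
        -- equations tie the ends of the arcs to the vertices fixed before h₂ was known.
        config : ∀ {h₂} → h₂ ∈ K → h₂ ≢ h₁ → Attached h₂ →
          Σ (Config h₁ h₂) λ c → Config.p₁ c ≡ p₁ × Config.qₗ c ≡ qₗ
        config h₂∈K h₂≢h₁ att₂ with ∈-resp-↭ K↭ h₂∈K
        ... | here refl = contradiction refl h₂≢h₁
        ... | there h₂∈K′ with splitAt pathK′ h₂∈K′
        ...   | inj₁ refl = contradiction att₂ ¬att-p₁
        ...   | inj₂ (split {P} pathP pₖh₂ path₂ K′↭) with uncons path₂
        ...     | inj₁ refl = contradiction att₂ ¬att-qₗ
        ...     | inj₂ (q₁ , Q , h₂q₁ , pathQ , l₂↭) = record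
          { pathP = pathP ; pathQ = pathQ ; h₁p₁ = h₁p₁ ; pₖh₂ = pₖh₂ ; h₂q₁ = h₂q₁ ; qₗh₁ = qₗh₁
          ; perm = ↭-sym (↭-trans K↭ (↭-prep h₁ (↭-trans K′↭ (↭-trans (↭-++ˡ P l₂↭)
              (shift _ P Q))))) } , refl , refl

        p₁∈K : p₁ ∈ K
        p₁∈K = ∈-resp-↭ (↭-sym K↭) (there (start∈ pathK′))

        p₁≢h₁ : p₁ ≢ h₁
        p₁≢h₁ refl = irr G h₁p₁

        qₗ≢h₁ : qₗ ≢ h₁
        qₗ≢h₁ refl = irr G qₗh₁

        noAttachedInD : ∀ {h₂} → h₂ ∈ˢ D → h₂ ∈ K → Attached h₂ → ⊥
        noAttachedInD {h₂} h₂∈D h₂∈K att₂ with config h₂∈K (D≢h₁ h₂∈D) att₂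
        ... | c , refl , refl = conclude (dominator h₂≁p₁ ¬att-p₁ p₁≢h₁) (dominator h₂≁qₗ ¬att-qₗ qₗ≢h₁)
          where
          h₂≁p₁ : ¬ Adj G h₂ p₁
          h₂≁p₁ = Facts₂.h₂≁p₁ c att₁ att₂

          h₂≁qₗ : ¬ Adj G h₂ qₗ
          h₂≁qₗ = Facts₂.h₂≁p₁ (flip c) att₁ att₂

          dominator : ∀ {x} → ¬ Adj G h₂ x → ¬ Attached x → x ≢ h₁ → ∃[ y ] (y ∈ˢ D × h₂ ≢ y × Adj G y x)
          dominator h₂≁x ¬att-x x≢h₁ with dominated x≢h₁
          -- If `x` itself lies in `D`, connectedness of `D` makes it a neighbour of h₂.
          ... | y , y∈D , inj₁ refl = contradiction (D-adj h₂∈D y∈D (λ { refl → ¬att-x att₂ })) h₂≁x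
          ... | y , y∈D , inj₂ yx = y , y∈D , (λ { refl → h₂≁x yx }) , yx

          conclude : ∃[ y ] (y ∈ˢ D × h₂ ≢ y × Adj G y p₁) → ∃[ z ] (z ∈ˢ D × h₂ ≢ z × Adj G z qₗ) → ⊥
          conclude (y , y∈D , h₂≢y , yp₁) (z , z∈D , h₂≢z , zqₗ)
            -- Besides h₂ there is room for one vertex in `D`, so the dominators of p₁ and qₗ
            -- coincide.
            with atMostTwo h₂∈D y∈D z∈D h₂≢y (≢-sym h₂≢z)
          ... | refl = noDominatingPair c att₁ att₂ (D≢h₁ y∈D) (D-adj h₂∈D y∈D h₂≢y) yp₁ zqₗ

        D-neighbour-of-H : ∀ {w z} → H w → z ∈ˢ D → Adj G w z → H z
        D-neighbour-of-H {z = z} Hw z∈D wz with z ∈? K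
        ... | yes z∈K = ⊥-elim (noAttachedInD z∈D z∈K (_ , Hw , sym G wz))
        ... | no z∉K = Reach-step Hw wz z∉K

        H-element : ∃[ x ] (x ∈ˢ D × H x)
        H-element with dominated {u} (λ { refl → u∉K (start∈ pathK) })
        ... | x , x∈D , inj₁ refl = x , x∈D , _ , [ u ] , u∉K ∷ []
        ... | x , x∈D , inj₂ xu = x , x∈D , D-neighbour-of-H (_ , [ u ] , u∉K ∷ []) x∈D (sym G xu)

        -- The dominator z of p₁ equals the element x of `D` in `H` or is adjacent to it, so z is in
        -- `H`; but p₁ lies on `K` and is unattached.
        impossible : ⊥
        impossible with H-element | dominated p₁≢h₁
        ... | x , x∈D , Hx | z , z∈D , z≡p₁⊎zp₁ with z ≟ᶠ x
        impossible | x , x∈D , Hx | z , z∈D , inj₁ refl | yes refl = H⇒∉K Hx p₁∈K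
        impossible | x , x∈D , Hx | z , z∈D , inj₂ zp₁ | yes refl = ¬att-p₁ (_ , Hx , sym G zp₁)
        impossible | x , x∈D , Hx | z , z∈D , z≡p₁⊎zp₁ | no z≢x
          with D-neighbour-of-H Hx z∈D (D-adj x∈D z∈D (≢-sym z≢x)) | z≡p₁⊎zp₁
        ... | Hz | inj₁ refl = H⇒∉K Hz p₁∈K
        ... | Hz | inj₂ zp₁ = ¬att-p₁ (_ , Hz , sym G zp₁)

    -- Induction on `k`, which bounds how much longer a cycle can get. Longer cycles are refuted
    -- with a smaller `k`, and this supplies the maximality required by `noMaximalCycle`.
    noCycle : ¬ Hamiltonian G → 2 < n → ∀ k {a l b} → n < length l + k →
      Seg a l b → Adj G b a → Unique l → ⊥
    noCycle _ _ zero {l = l} n< _ _ u rewrite ℕ.+-identityʳ (length l) =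
      ℕ.<⇒≱ n< (unique⇒length≤n u)
    noCycle ¬ham 2<n (suc k) {l = l} n< s ba uniqueL with all? (_∈? l)
    ... | no ¬cover with ¬∀⟶∃¬ n (_∈ l) (_∈? l) ¬cover
    ...   | u , u∉l = noMaximalCycle s ba uniqueL u∉l λ t e unique l<m →
      noCycle ¬ham 2<n k
        (ℕ.<-≤-trans (subst (n <_) (ℕ.+-suc (length l) k) n<) (ℕ.+-monoˡ-≤ k l<m)) t e unique
    noCycle ¬ham 2<n (suc k) n< [ a ] aa _ | yes _ = irr G aa
    noCycle ¬ham 2<n (suc k) n< (e ∷ s) ba uniqueL | yes cover with Seg-snoc e s
    ... | xs , refl = ¬ham (_ , xs , _ , Seg-chain (e ∷ s) , uniqueL , cover ,
      ℕ.≤-trans 2<n (covering⇒n≤length cover) , ba)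

theorem3p7 : (n : ℕ) (G : Graph n) → TwoConnected G → VertexCritical G 3 → ClawFree G → Hamiltonian G
theorem3p7 n@(suc (suc (suc _))) G (2<n@(s≤s (s≤s (s≤s _))) , connected , _) (_ , critical) clawFree =
  decidable-stable (hamiltonian? G) λ ¬ham → fromEdge ¬ham (connected zero (suc zero) Subset.∈⊤ Subset.∈⊤)
  where
  open Paths G
  fromEdge : ¬ Hamiltonian G → WalkIn G ⊤ zero (suc zero) → ⊥
  -- An edge traversed back and forth serves as the initial closed path, of length two.
  fromEdge ¬ham (step {y = y} _ e _) =
    Extension.noCycle G clawFree connected critical ¬ham 2<n n (ℕ.m≤n+m (suc n) 1) (e ∷ [ y ]) (sym G e)
      (((λ { refl → irr G e }) ∷ []) ∷ [] ∷ [])
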